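{- Let $G$ be an Abelian group of order $n$, let $m\ge 2$, let $K=(k_1,\dots,k_m)$ be a tuple of positive integers, $a=\sum_{i=1}^m k_i$, $\widetilde{k}=\mathrm{lcm}(k_1,\dots,k_m)$, let $\lambda$ be a positive integer and let $\rho=\frac{\lambda}{\widetilde{k}m}$. There exists a weak $(n,m,a,\rho)$-AMD code $(S,G,\mathcal{A},E_u)$ with $S=\{s_1,\dots,s_m\}$ and $(|A_{s_1}|,\dots,|A_{s_m}|)=K$ if and only if there exists an $(n,m,K,a,\lambda)$-BSWEDF over $G$.
   Context: All groups are written additively with identity $0$. Weak AMD code: let $S$ be a set of $m$ source messages, $G$ an Abelian group of order $n$, and $\mathcal{A}=\{A_s : s\in S\}$ a family of pairwise disjoint nonempty subsets of $G$ ($A_s$ is the set of valid encodings of $s$). A source $s\in S$ is chosen uniformly at random, and $E_u$ encodes $s$ as a uniformly random $g\in A_s$. The adversary, with no knowledge of $s$ or $g$, chooses $\Delta\in G\setminus\{0\}$ and wins if $g+\Delta\in A_{s'}$ for some $s'\neq s$. Let $\rho_\Delta$ be the probability that the adversary wins with $\Delta$, i.e. $\rho_\Delta=\frac1m\sum_{s\in S}\frac{1}{|A_s|}\,|\{g\in A_s : g+\Delta\in\bigcup_{s'\ne s}A_{s'}\}|$. Then $(S,G,\mathcal{A},E_u)$ is a weak $(n,m,a,\rho)$-AMD code, where $a=\sum_{s\in S}|A_s|$ and $\rho=\max\{\rho_\Delta : \Delta\in G\setminus\{0\}\}$. BSWEDF: for multi-sets $B_1,B_2$ of elements of $G$, $D(B_1,B_2)$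 is the multi-set $\{x-y : x\in B_1,\ y\in B_2\}$; for a positive integer $k$ and a multi-set $B$, $k\boxtimes B$ is the multi-set in which each element of $B$ is repeated $k$ times; unions are multi-set unions (multiplicities add). Let $\mathcal{B}=\{B_i : 1\le i\le m\}$ be a family of pairwise disjoint nonempty subsets of $G$, $k_i=|B_i|$, $K=(k_1,\dots,k_m)$, $a=\sum_i k_i$, $\widetilde{k}=\mathrm{lcm}(k_1,\dots,k_m)$, and $\widetilde{B}_i=\frac{\widetilde{k}}{k_i}\boxtimes B_i$. Then $\mathcal{B}$ is an $(n,m,K,a,\lambda)$-bounded standard weighted external difference family (BSWEDF) over $G$ if $\lambda$ is the smallest positive integer such that $\bigcup_{1\le i\ne j\le m}D(B_i,\widetilde{B}_j)\subseteq\lambda\boxtimes(G\setminus\{0\})$. -}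

module Defs where

open import Level using (Level; _⊔_) renaming (suc to lsuc)
open import Algebra.Bundles using (AbelianGroup)
import Algebra.Properties.CommutativeMonoid.Sum as Sum
import Data.Fin as Fin
open import Data.Fin using (Fin)
open import Data.Fin.Properties using (inj⇒≟)
open import Data.Integer using (+_)
open import Data.List as List
  using (List; length; filter; concatMap; replicate; allFin; cartesianProductWith)
import Data.List.Membership.DecSetoid as DecMembership
import Data.List.Relation.Binary.Disjoint.Setoid as SetoidDisjoint
import Data.List.Relation.Unary.Unique.Setoid as SetoidUnique
open import Data.Nat as ℕ using (ℕ; zero; suc; _≤_; _<_; NonZero; ≢-nonZero; ≢-nonZero⁻¹)
open import Data.Nat.GCD using (gcd)
open import Data.Nat.LCM using (lcm; gcd*lcm)
import Data.Nat.Properties as ℕ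
open import Data.Product using (_×_; ∃-syntax)
open import Data.Rational as ℚ using (ℚ; _/_)
import Data.Rational.Properties as ℚ
open import Data.Vec.Functional as Vector using (Vector)
open import Function.Bundles using (Inverse; _↔_)
open import Function.Properties.Inverse using (Inverse⇒Injection)
import Function.Construct.Symmetry as Symmetry
open import Relation.Binary.Bundles using (DecSetoid)
open import Relation.Binary.Definitions using (DecidableEquality)
open import Relation.Binary.PropositionalEquality as ≡ using (_≡_; _≢_)
open import Relation.Nullary using (¬_)
open import Relation.Nullary.Decidable using (¬?)

private
  variable
    c ℓ : Level
    n m : ℕ

∑ℕ : Vector ℕ m → ℕ
∑ℕ = Sum.sum ℕ.+-0-commutativeMonoid

∑ℚ : Vector ℚ m → ℚ
∑ℚ = Sum.sum ℚ.+-0-commutativeMonoid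

lcms : Vector ℕ m → ℕ
lcms = Vector.foldr lcm 1

lcm≢0 : ∀ i j → .{{NonZero i}} → .{{NonZero j}} → NonZero (lcm i j)
lcm≢0 i j = ≢-nonZero λ lcm≡0 → ≢-nonZero⁻¹ (i ℕ.* j) {{ℕ.m*n≢0 i j}}
  (≡.trans (≡.sym (gcd*lcm i j)) (≡.trans (≡.cong (gcd i j ℕ.*_) lcm≡0) (ℕ.*-zeroʳ (gcd i j))))

lcms≢0 : (K : Vector ℕ m) → (∀ i → NonZero (K i)) → NonZero (lcms K)
lcms≢0 {zero}  K K≢0 = _
lcms≢0 {suc m} K K≢0 = lcm≢0 (K Fin.zero) (lcms (Vector.tail K))
  {{K≢0 Fin.zero}} {{lcms≢0 (Vector.tail K) (λ i → K≢0 (Fin.suc i))}}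

HasOrder : AbelianGroup c ℓ → ℕ → Set (c ⊔ ℓ)
HasOrder G n = Inverse (AbelianGroup.setoid G) (≡.setoid (Fin n))

module _ (G : AbelianGroup c ℓ) (order : HasOrder G n) where

  open AbelianGroup G using (Carrier; _≈_; _≉_; _-_; isEquivalence; setoid)
    renaming (_∙_ to _+_; ε to 0#)

  ≈-decSetoid : DecSetoid c ℓ
  ≈-decSetoid = record
    { isDecEquivalence = record
      { isEquivalence = isEquivalence
      ; _≟_           = inj⇒≟ (Inverse⇒Injection order)
      }
    }

  open DecSetoid ≈-decSetoid using (_≟_)
  open DecMembership ≈-decSetoid using (_∈?_)
  open SetoidDisjoint setoid using (Disjoint)
  open SetoidUnique setoid using (Unique)

  -- A subset of G is given by a repetition-free listing, so that its cardinality
  -- is the length of the list.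
  record Subset : Set (c ⊔ ℓ) where
    field
      elements : List Carrier
      unique   : Unique elements

  open Subset public

  ∣_∣ : Subset → ℕ
  ∣ B ∣ = length (elements B)

  record DisjointFamily (I : Set) : Set (c ⊔ ℓ) where
    field
      member   : I → Subset
      nonempty : ∀ i → NonZero ∣ member i ∣
      disjoint : ∀ {i j} → i ≢ j → Disjoint (elements (member i)) (elements (member j))

  open DisjointFamily public

  -- Multi-sets are lists, of which only the multiplicities matter; multi-set
  -- union is concatenation.
  MultiSet : Set c
  MultiSet = List Carrier

  multiplicity : Carrier → MultiSet → ℕ
  multiplicity x B = length (filter (x ≟_) B)

  infix 4 _⊆ₘ_
  _⊆ₘ_ : MultiSet → MultiSet → Set c
  B ⊆ₘ C = ∀ x → multiplicity x B ≤ multiplicity x C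

  D : MultiSet → MultiSet → MultiSet
  D = cartesianProductWith _-_

  infixr 7 _⊠_
  _⊠_ : ℕ → MultiSet → MultiSet
  k ⊠ B = concatMap (replicate k) B

  G∖0 : MultiSet
  G∖0 = filter (λ x → ¬? (x ≟ 0#)) (List.map (Inverse.from order) (allFin n))

  module _ (B : DisjointFamily (Fin m)) where

    sizes : Vector ℕ m
    sizes i = ∣ member B i ∣

    weighted : Fin m → MultiSet
    weighted i = (lcms sizes ℕ./ sizes i) {{nonempty B i}} ⊠ elements (member B i)

    externalDifferences : MultiSet
    externalDifferences =
      concatMap (λ i →
        concatMap (λ j → D (elements (member B i)) (weighted j))
          (filter (λ j → ¬? (i Fin.≟ j)) (allFin m)))
        (allFin m)

    Bounds : ℕ → Set c
    Bounds lam = 0 < lam × externalDifferences ⊆ₘ lam ⊠ G∖0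

  record BSWEDF (m : ℕ) (K : Vector ℕ m) (a lam : ℕ) : Set (c ⊔ ℓ) where
    field
      family   : DisjointFamily (Fin m)
      sizes≡K  : ∀ i → ∣ member family i ∣ ≡ K i
      total    : a ≡ ∑ℕ (λ i → ∣ member family i ∣)
      bounds   : Bounds family lam
      smallest : ∀ lam′ → Bounds family lam′ → lam ≤ lam′

  module _ {S : Set} (sources : Fin m ↔ S) (A : DisjointFamily S) where

    source : Fin m → S
    source = Inverse.to sources

    _≟ₛ_ : DecidableEquality S
    _≟ₛ_ = inj⇒≟ (Inverse⇒Injection (Symmetry.inverse sources))

    -- ⋃ of the A s′ over s′ ≠ s
    otherEncodings : S → List Carrier
    otherEncodings s =
      concatMap (λ s′ → elements (member A s′))
        (filter (λ s′ → ¬? (s′ ≟ₛ s)) (List.map source (allFin m)))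

    winning : Carrier → S → List Carrier
    winning Δ s = filter (λ g → (g + Δ) ∈? otherEncodings s) (elements (member A s))

    -- ρ_Δ: the source s is uniform on S and, given s, the encoding is uniform on
    -- A s; this is the only way in which the encoding function E_u enters.
    winProbability : .{{NonZero m}} → Carrier → ℚ
    winProbability Δ =
      (+ 1 / m) ℚ.* ∑ℚ (λ i → let s = source i in
        (+ 1 / ∣ member A s ∣) {{nonempty A s}} ℚ.* (+ length (winning Δ s) / 1))

  record WeakAMDCode (m a : ℕ) .{{_ : NonZero m}} (ρ : ℚ) : Set (lsuc Level.zero ⊔ c ⊔ ℓ) where
    field
      S         : Set
      sources   : Fin m ↔ S
      encodings : DisjointFamily S
      total     : a ≡ ∑ℕ (λ i → ∣ member encodings (Inverse.to sources i) ∣)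
      attained  : ∃[ Δ ] (Δ ≉ 0#) × (winProbability sources encodings Δ ≡ ρ)
      maximal   : ∀ Δ → Δ ≉ 0# → winProbability sources encodings Δ ℚ.≤ ρ

    encodingSize : Vector ℕ m
    encodingSize i = ∣ member encodings (Inverse.to sources i) ∣

-- Fix Δ and let N(i , j) be the number of pairs (x , y) ∈ Bᵢ × Bⱼ with x - y ≈ Δ.
-- In the multi-set of external differences Δ has multiplicity Σ_{i≠j} (k̃ / kⱼ) N(i , j).
-- On the other hand the sets Bᵢ are disjoint, so an encoding y ∈ Bⱼ of j is won by the
-- adversary iff it occurs in exactly one pair counted by some N(i , j) with i ≠ j, and
-- hence ρ_Δ = (1 / m) Σ_{i≠j} N(i , j) / kⱼ.  Thus ρ_Δ is the multiplicity of Δ divided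
-- by k̃ m, so the maximal ρ_Δ corresponds to the largest multiplicity, i.e. to the smallest λ.
module Submission where

open import Defs
open import Algebra.Bundles using (AbelianGroup)
import Algebra.Properties.Group as GroupProperties
import Algebra.Properties.Monoid.Sum as MonoidSum
open import Data.Bool using (if_then_else_; true; false)
open import Data.Fin as Fin using (Fin)
open import Data.Fin.Properties using (any?)
open import Data.Integer as ℤ using (+_)
import Data.Integer.Properties as ℤ
open import Data.List as List
  using (List; []; _∷_; _++_; length; map; filter; concatMap; replicate; allFin; cartesianProductWith)
import Data.List.Membership.DecSetoid as DecMembership
open import Data.List.Membership.Propositional.Properties using (∈-allFin; ∈-filter⁺)
import Data.List.Membership.Setoid.Properties as Membership
open import Data.List.Properties
  using (map-cong; map-∘; map-tabulate; filter-accept; filter-reject; filter-none; filter-some)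
import Data.List.Relation.Unary.All as All
import Data.List.Relation.Unary.All.Properties as All
import Data.List.Relation.Unary.AllPairs as AllPairs
import Data.List.Relation.Unary.AllPairs.Properties as AllPairs
open import Data.List.Relation.Unary.Any as Any using (here; there)
import Data.List.Relation.Unary.Any.Properties as Any
import Data.List.Relation.Unary.Unique.Propositional.Properties as Unique≡
import Data.List.Relation.Unary.Unique.Setoid.Properties as Unique
import Data.List.Relation.Unary.Unique.Setoid as SetoidUnique
open import Data.Nat as ℕ
  using (ℕ; zero; suc; _+_; _≤_; _<_; _*_; NonZero; >-nonZero; >-nonZero⁻¹; z≤n; s≤s; _≤?_)
open import Data.Nat.Divisibility using (_∣_; ∣-trans; ∣⇒≤)
open import Data.Nat.DivMod using (m/n*n≡m; m≥n⇒m/n>0)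
open import Data.Nat.LCM using (lcm; m∣lcm[m,n]; n∣lcm[m,n])
open import Data.Nat.ListAction using (sum)
open import Data.Nat.Properties as ℕ using (m*n≢0; ≤-trans)
open import Data.Nat.Solver using (module +-*-Solver)
open import Data.Product using (Σ-syntax; ∃-syntax; _×_; _,_)
open import Data.Rational as ℚ using (ℚ; _/_)
import Data.Rational.Properties as ℚ
open import Data.Rational.Unnormalised as ℚᵘ using (mkℚᵘ; *≡*; *≤*)
import Data.Rational.Unnormalised.Properties as ℚᵘ
open import Data.Vec.Functional as Vector using (Vector)
open import Function using (_∘_; id)
open import Function.Bundles using (_⇔_; mk⇔; _↔_; Inverse)
open import Function.Construct.Identity using (↔-id)
open import Level using (Level)
open import Relation.Binary.Bundles using (DecSetoid)
open import Relation.Binary.PropositionalEquality as ≡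
  using (_≡_; _≢_; refl; sym; trans; cong; cong₂; subst; module ≡-Reasoning)
open import Relation.Nullary using (Dec; yes; no; does; contradiction)
open import Relation.Nullary.Decidable using (¬?)
open import Relation.Unary using (Pred; Decidable)

private
  variable
    a b p : Level
    A : Set a
    B : Set b

module ∑ℕ where
  open MonoidSum ℕ.+-0-monoid public using ()
    renaming (sum-cong-≗ to cong; sum-replicate-zero to replicate-zero)

module ∑ℚ where
  open MonoidSum ℚ.+-0-monoid public using () renaming (sum-cong-≗ to cong)

-- Sums over lists

∑ : (A → ℕ) → List A → ℕ
∑ f xs = sum (map f xs)

∑-cong : {f g : A → ℕ} → (∀ x → f x ≡ g x) → ∀ xs → ∑ f xs ≡ ∑ g xs
∑-cong f≗g xs = cong sum (map-cong f≗g xs)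

∑-++ : ∀ (f : A → ℕ) xs ys → ∑ f (xs ++ ys) ≡ ∑ f xs + ∑ f ys
∑-++ f []       ys = refl
∑-++ f (x ∷ xs) ys = trans (cong (f x ℕ.+_) (∑-++ f xs ys)) (sym (ℕ.+-assoc (f x) _ _))

∑-map : ∀ (f : B → ℕ) (g : A → B) xs → ∑ f (map g xs) ≡ ∑ (f ∘ g) xs
∑-map f g xs = cong sum (sym (map-∘ xs))

∑-concatMap : ∀ (f : B → ℕ) (g : A → List B) xs →
              ∑ f (concatMap g xs) ≡ ∑ (λ x → ∑ f (g x)) xs
∑-concatMap f g []       = refl
∑-concatMap f g (x ∷ xs) =
  trans (∑-++ f (g x) _) (cong (∑ f (g x) ℕ.+_) (∑-concatMap f g xs))

∑-cartesianProductWith : ∀ {c} {C : Set c} (f : C → ℕ) (g : A → B → C) xs ys →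
  ∑ f (cartesianProductWith g xs ys) ≡ ∑ (λ x → ∑ (λ y → f (g x y)) ys) xs
∑-cartesianProductWith f g []       ys = refl
∑-cartesianProductWith f g (x ∷ xs) ys =
  trans (∑-++ f (map (g x) ys) _)
        (cong₂ _+_ (∑-map f (g x) ys) (∑-cartesianProductWith f g xs ys))

∑-replicate : ∀ (f : A → ℕ) k x → ∑ f (replicate k x) ≡ k * f x
∑-replicate f zero    x = refl
∑-replicate f (suc k) x = cong (f x ℕ.+_) (∑-replicate f k x)

∑-zero : ∀ (xs : List A) → ∑ (λ _ → 0) xs ≡ 0
∑-zero []       = refl
∑-zero (x ∷ xs) = ∑-zero xs

∑-distrib-+ : ∀ (f g : A → ℕ) xs → ∑ (λ x → f x + g x) xs ≡ ∑ f xs + ∑ g xs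
∑-distrib-+ f g []       = refl
∑-distrib-+ f g (x ∷ xs) =
  trans (cong (f x + g x ℕ.+_) (∑-distrib-+ f g xs))
        (solve 4 (λ a b c d → (a :+ b) :+ (c :+ d) := (a :+ c) :+ (b :+ d)) refl
          (f x) (g x) (∑ f xs) (∑ g xs))
  where open +-*-Solver

*-distribˡ-∑ : ∀ k (f : A → ℕ) xs → ∑ (λ x → k * f x) xs ≡ k * ∑ f xs
*-distribˡ-∑ k f []       = sym (ℕ.*-zeroʳ k)
*-distribˡ-∑ k f (x ∷ xs) =
  trans (cong (k * f x ℕ.+_) (*-distribˡ-∑ k f xs)) (sym (ℕ.*-distribˡ-+ k (f x) _))

-- Used to pass from the order in which the differences are listed to a count made encoding by
-- encoding.
∑-comm : ∀ (f : A → B → ℕ) xs ys → ∑ (λ x → ∑ (f x) ys) xs ≡ ∑ (λ y → ∑ (λ x → f x y) xs) ys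
∑-comm f []       ys = sym (∑-zero ys)
∑-comm f (x ∷ xs) ys =
  trans (cong (∑ (f x) ys ℕ.+_) (∑-comm f xs ys))
        (sym (∑-distrib-+ (f x) (λ y → ∑ (λ x′ → f x′ y) xs) ys))

∑-allFin : ∀ {m} (f : Vector ℕ m) → ∑ f (allFin m) ≡ ∑ℕ f
∑-allFin {zero}  f = refl
∑-allFin {suc m} f = cong (f Fin.zero ℕ.+_) (begin
  ∑ f (List.tabulate Fin.suc)      ≡⟨ cong (∑ f) (map-tabulate id Fin.suc) ⟨
  ∑ f (map Fin.suc (allFin m))     ≡⟨ ∑-map f Fin.suc (allFin m) ⟩
  ∑ (f ∘ Fin.suc) (allFin m)       ≡⟨ ∑-allFin (f ∘ Fin.suc) ⟩
  ∑ℕ (f ∘ Fin.suc)                 ∎)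
  where open ≡-Reasoning

term≤∑ℕ : ∀ {m} (f : Vector ℕ m) i → f i ≤ ∑ℕ f
term≤∑ℕ f Fin.zero    = ℕ.m≤m+n (f Fin.zero) _
term≤∑ℕ f (Fin.suc i) = ≤-trans (term≤∑ℕ (f ∘ Fin.suc) i) (ℕ.m≤n+m _ (f Fin.zero))

-- Branches on `does`, as `filter` does, so that one `with does (P? x)` reduces an indicator and a
-- filtered list together.
𝟙 : Dec A → ℕ
𝟙 A? = if does A? then 1 else 0

𝟙-cong : (A? : Dec A) (B? : Dec B) → (A → B) → (B → A) → 𝟙 A? ≡ 𝟙 B?
𝟙-cong (yes _)  (yes _)  A→B B→A = refl
𝟙-cong (yes x)  (no ¬B)  A→B B→A = contradiction (A→B x) ¬B
𝟙-cong (no ¬A)  (yes y)  A→B B→A = contradiction (B→A y) ¬A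
𝟙-cong (no _)   (no _)   A→B B→A = refl

-- Turns a restricted range of summation into a factor. A double sum over i ≠ j then runs over a
-- full square, where `∑-comm` applies.
∑-filter : {P : Pred A p} (P? : Decidable P) (f : A → ℕ) →
           ∀ xs → ∑ f (filter P? xs) ≡ ∑ (λ x → 𝟙 (P? x) * f x) xs
∑-filter P? f []       = refl
∑-filter P? f (x ∷ xs) with does (P? x)
... | true  = cong₂ _+_ (sym (ℕ.+-identityʳ (f x))) (∑-filter P? f xs)
... | false = ∑-filter P? f xs

length-filter-∑ : {P : Pred A p} (P? : Decidable P) →
                  ∀ xs → length (filter P? xs) ≡ ∑ (𝟙 ∘ P?) xs
length-filter-∑ P? []       = refl
length-filter-∑ P? (x ∷ xs) with does (P? x)
... | true  = cong suc (length-filter-∑ P? xs)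
... | false = length-filter-∑ P? xs

-- Fractions of natural numbers

-- Elements of `ℚ` are in lowest terms, so operations on them do not reduce for variable numerators.
-- But `+ a / suc b-1` is by definition `fromℚᵘ (mkℚᵘ (+ a) b-1)`, so the laws of fractions below
-- can be checked in `ℚᵘ` by integer cross-multiplication.
fromℚᵘ-homo-* : ∀ p q → ℚ.fromℚᵘ p ℚ.* ℚ.fromℚᵘ q ≡ ℚ.fromℚᵘ (p ℚᵘ.* q)
fromℚᵘ-homo-* p q = ℚ.toℚᵘ-injective
  (ℚᵘ.≃-trans (ℚ.toℚᵘ-homo-* (ℚ.fromℚᵘ p) (ℚ.fromℚᵘ q))
  (ℚᵘ.≃-trans (ℚᵘ.*-cong (ℚ.toℚᵘ-fromℚᵘ p) (ℚ.toℚᵘ-fromℚᵘ q))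
              (ℚᵘ.≃-sym (ℚ.toℚᵘ-fromℚᵘ (p ℚᵘ.* q)))))

fromℚᵘ-homo-+ : ∀ p q → ℚ.fromℚᵘ p ℚ.+ ℚ.fromℚᵘ q ≡ ℚ.fromℚᵘ (p ℚᵘ.+ q)
fromℚᵘ-homo-+ p q = ℚ.toℚᵘ-injective
  (ℚᵘ.≃-trans (ℚ.toℚᵘ-homo-+ (ℚ.fromℚᵘ p) (ℚ.fromℚᵘ q))
  (ℚᵘ.≃-trans (ℚᵘ.+-cong (ℚ.toℚᵘ-fromℚᵘ p) (ℚ.toℚᵘ-fromℚᵘ q))
              (ℚᵘ.≃-sym (ℚ.toℚᵘ-fromℚᵘ (p ℚᵘ.+ q)))))

/-≡ : ∀ a c b d .{{_ : NonZero b}} .{{_ : NonZero d}} →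
      a * d ≡ c * b → + a / b ≡ + c / d
/-≡ a c b@(suc b-1) d@(suc d-1) eq =
  ℚ.fromℚᵘ-cong {mkℚᵘ (+ a) b-1} {mkℚᵘ (+ c) d-1}
    (*≡* (trans (sym (ℤ.pos-* a d)) (trans (cong +_ eq) (ℤ.pos-* c b))))

/-* : ∀ a c b d .{{_ : NonZero b}} .{{_ : NonZero d}} →
      (+ a / b) ℚ.* (+ c / d) ≡ (+ (a * c) / (b * d)) {{m*n≢0 b d}}
/-* a c (suc b-1) (suc d-1) =
  trans (fromℚᵘ-homo-* (mkℚᵘ (+ a) b-1) (mkℚᵘ (+ c) d-1))
        (ℚ./-cong {q₁ = suc b-1 * suc d-1} (sym (ℤ.pos-* a c)) refl)

/-+ : ∀ a c b .{{_ : NonZero b}} → (+ a / b) ℚ.+ (+ c / b) ≡ + (a + c) / b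
/-+ a c b@(suc b-1) =
  trans (fromℚᵘ-homo-+ (mkℚᵘ (+ a) b-1) (mkℚᵘ (+ c) b-1))
        (ℚ.fromℚᵘ-cong {mkℚᵘ (+ a) b-1 ℚᵘ.+ mkℚᵘ (+ c) b-1} {mkℚᵘ (+ (a + c)) b-1} (*≡* (begin
    (+ a ℤ.* + b ℤ.+ + c ℤ.* + b) ℤ.* + b   ≡⟨ cong (ℤ._* + b) (ℤ.*-distribʳ-+ (+ b) (+ a) (+ c)) ⟨
    (+ (a + c) ℤ.* + b) ℤ.* + b             ≡⟨ ℤ.*-assoc (+ (a + c)) (+ b) (+ b) ⟩
    + (a + c) ℤ.* (+ b ℤ.* + b)             ∎)))
  where open ≡-Reasoning

/-≤⁺ : ∀ a c b .{{_ : NonZero b}} → a ≤ c → + a / b ℚ.≤ + c / b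
/-≤⁺ a c (suc b-1) a≤c = ℚ.toℚᵘ-cancel-≤
  (ℚᵘ.≤-respˡ-≃ (ℚᵘ.≃-sym (ℚ.toℚᵘ-fromℚᵘ (mkℚᵘ (+ a) b-1)))
  (ℚᵘ.≤-respʳ-≃ (ℚᵘ.≃-sym (ℚ.toℚᵘ-fromℚᵘ (mkℚᵘ (+ c) b-1)))
    (*≤* (ℤ.*-monoʳ-≤-nonNeg (+ suc b-1) (ℤ.+≤+ a≤c)))))

/-≤⁻ : ∀ a c b .{{_ : NonZero b}} → + a / b ℚ.≤ + c / b → a ≤ c
/-≤⁻ a c (suc b-1) a/b≤c/b =
  ℤ.drop‿+≤+ (ℤ.*-cancelʳ-≤-pos (+ a) (+ c) (+ suc b-1) (ℚᵘ.drop-*≤*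
    (ℚᵘ.≤-respˡ-≃ (ℚ.toℚᵘ-fromℚᵘ (mkℚᵘ (+ a) b-1))
    (ℚᵘ.≤-respʳ-≃ (ℚ.toℚᵘ-fromℚᵘ (mkℚᵘ (+ c) b-1))
      (ℚ.toℚᵘ-mono-≤ a/b≤c/b)))))

/-injective : ∀ a c b .{{_ : NonZero b}} → + a / b ≡ + c / b → a ≡ c
/-injective a c b eq = ℕ.≤-antisym (/-≤⁻ a c b (ℚ.≤-reflexive eq))
                                   (/-≤⁻ c a b (ℚ.≤-reflexive (sym eq)))

∑ℚ-/ : ∀ {m} (f : Vector ℕ m) b .{{_ : NonZero b}} → ∑ℚ (λ i → + f i / b) ≡ + ∑ℕ f / b
-- The empty sum is 0/1, while the right-hand side is 0/b.
∑ℚ-/ {zero}  f b = /-≡ 0 0 1 b refl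
∑ℚ-/ {suc m} f b = trans (cong ((+ f Fin.zero / b) ℚ.+_) (∑ℚ-/ (f ∘ Fin.suc) b))
                         (/-+ (f Fin.zero) (∑ℕ (f ∘ Fin.suc)) b)

-- Least common multiple of the sizes

∣lcms : ∀ {m} (K : Vector ℕ m) i → K i ∣ lcms K
∣lcms K Fin.zero    = m∣lcm[m,n] (K Fin.zero) (lcms (Vector.tail K))
∣lcms K (Fin.suc i) =
  ∣-trans (∣lcms (Vector.tail K) i) (n∣lcm[m,n] (K Fin.zero) (lcms (Vector.tail K)))

lcms-cong : ∀ {m} {K L : Vector ℕ m} → (∀ i → K i ≡ L i) → lcms K ≡ lcms L
lcms-cong {zero}  K≗L = refl
lcms-cong {suc m} K≗L = cong₂ lcm (K≗L Fin.zero) (lcms-cong (K≗L ∘ Fin.suc))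

module _ {c ℓ} (G : AbelianGroup c ℓ) {n : ℕ} (order : HasOrder G n) where

  open AbelianGroup G using (Carrier; _≈_; _≉_; setoid; group)
    renaming (_∙_ to _⊹_; _-_ to _⊖_; ε to 0#)
  private module G = AbelianGroup G
  open GroupProperties group using (//-rightDividesˡ; //-rightDividesʳ)
  open DecSetoid (≈-decSetoid G order) using (_≟_)
  open DecMembership (≈-decSetoid G order) using (_∈_; _∉_; _∈?_)
  open SetoidUnique setoid using (Unique)

  -- Multiplicities in multi-sets over `G`

  mult : Carrier → MultiSet G order → ℕ
  mult = multiplicity G order

  mult-∑ : ∀ x B → mult x B ≡ ∑ (λ y → 𝟙 (x ≟ y)) B
  mult-∑ x B = length-filter-∑ (x ≟_) B

  mult-cong : ∀ {x y} → x ≈ y → ∀ B → mult x B ≡ mult y B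
  mult-cong {x} {y} x≈y B = begin
    mult x B                ≡⟨ mult-∑ x B ⟩
    ∑ (λ z → 𝟙 (x ≟ z)) B   ≡⟨ ∑-cong (λ z → 𝟙-cong (x ≟ z) (y ≟ z)
                                 (G.trans (G.sym x≈y)) (G.trans x≈y)) B ⟩
    ∑ (λ z → 𝟙 (y ≟ z)) B   ≡⟨ mult-∑ y B ⟨
    mult y B                ∎
    where open ≡-Reasoning

  mult-concatMap : ∀ {a} {A : Set a} x (f : A → List Carrier) xs →
                   mult x (concatMap f xs) ≡ ∑ (λ y → mult x (f y)) xs
  mult-concatMap x f xs = begin
    mult x (concatMap f xs)                     ≡⟨ mult-∑ x (concatMap f xs) ⟩
    ∑ (λ y → 𝟙 (x ≟ y)) (concatMap f xs)        ≡⟨ ∑-concatMap _ f xs ⟩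
    ∑ (λ y → ∑ (λ z → 𝟙 (x ≟ z)) (f y)) xs      ≡⟨ ∑-cong (λ y → mult-∑ x (f y)) xs ⟨
    ∑ (λ y → mult x (f y)) xs                   ∎
    where open ≡-Reasoning

  ∑-⊠ : ∀ (f : Carrier → ℕ) k B → ∑ f (_⊠_ G order k B) ≡ k * ∑ f B
  ∑-⊠ f k B = begin
    ∑ f (concatMap (replicate k) B)       ≡⟨ ∑-concatMap f (replicate k) B ⟩
    ∑ (λ x → ∑ f (replicate k x)) B       ≡⟨ ∑-cong (∑-replicate f k) B ⟩
    ∑ (λ x → k * f x) B                   ≡⟨ *-distribˡ-∑ k f B ⟩
    k * ∑ f B                             ∎
    where open ≡-Reasoning

  mult-⊠ : ∀ x k B → mult x (_⊠_ G order k B) ≡ k * mult x B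
  mult-⊠ x k B = trans (mult-∑ x (_⊠_ G order k B))
    (trans (∑-⊠ (λ y → 𝟙 (x ≟ y)) k B) (cong (k *_) (sym (mult-∑ x B))))

  ≈-⇒+≈ : ∀ {d x y} → d ≈ x ⊖ y → y ⊹ d ≈ x
  ≈-⇒+≈ {d} {x} {y} d≈x-y = G.trans (G.∙-congˡ d≈x-y)
    (G.trans (G.comm y (x ⊖ y)) (//-rightDividesˡ y x))

  +≈⇒≈- : ∀ {d x y} → y ⊹ d ≈ x → d ≈ x ⊖ y
  +≈⇒≈- {d} {x} {y} y+d≈x = G.trans (G.sym (//-rightDividesʳ y d))
    (G.∙-congʳ (G.trans (G.comm d y) y+d≈x))

  -- For fixed y, d ≈ x - y holds iff y + d ≈ x. Summing over y last gives the adversary's view: y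
  -- is an encoding, and its shift by d is looked up in X. Repetitions in Y are allowed, so `Y` can
  -- be a weighted set.
  mult-D : ∀ d X Y → mult d (D G order X Y) ≡ ∑ (λ y → mult (y ⊹ d) X) Y
  mult-D d X Y = begin
    mult d (D G order X Y)                            ≡⟨ mult-∑ d (D G order X Y) ⟩
    ∑ (λ z → 𝟙 (d ≟ z)) (D G order X Y)               ≡⟨ ∑-cartesianProductWith _ _⊖_ X Y ⟩
    ∑ (λ x → ∑ (λ y → 𝟙 (d ≟ (x ⊖ y))) Y) X           ≡⟨ ∑-comm _ X Y ⟩
    ∑ (λ y → ∑ (λ x → 𝟙 (d ≟ (x ⊖ y))) X) Y           ≡⟨ ∑-cong (λ y → ∑-cong (λ x →
                                                           𝟙-cong (d ≟ (x ⊖ y)) ((y ⊹ d) ≟ x)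
                                                             ≈-⇒+≈ +≈⇒≈-) X) Y ⟩
    ∑ (λ y → ∑ (λ x → 𝟙 ((y ⊹ d) ≟ x)) X) Y           ≡⟨ ∑-cong (λ y → mult-∑ (y ⊹ d) X) Y ⟨
    ∑ (λ y → mult (y ⊹ d) X) Y                        ∎
    where open ≡-Reasoning

  mult-∉ : ∀ {x B} → x ∉ B → mult x B ≡ 0
  mult-∉ {x} {B} x∉B = cong length (filter-none (x ≟_) (All.¬Any⇒All¬ B x∉B))

  -- Once x matches the head, a second match in the tail would be equal to the head, contrary to
  -- uniqueness.
  mult-∈ : ∀ {x B} → Unique B → x ∈ B → mult x B ≡ 1
  mult-∈ {x} (y∉B AllPairs.∷ B!) (here x≈y) =
    trans (cong length (filter-accept (x ≟_) x≈y)) (cong suc (mult-∉ λ x∈B →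
      All.All¬⇒¬Any y∉B (Membership.∈-resp-≈ setoid x≈y x∈B)))
  mult-∈ {x} (y∉B AllPairs.∷ B!) (there x∈B) =
    trans (cong length (filter-reject (x ≟_) λ x≈y →
      All.All¬⇒¬Any y∉B (Membership.∈-resp-≈ setoid x≈y x∈B)))
      (mult-∈ B! x∈B)

  -- Replaces a membership test by a count, which is additive over unions of lists.
  𝟙-∈? : ∀ {B} → Unique B → ∀ x → 𝟙 (x ∈? B) ≡ mult x B
  𝟙-∈? {B} B! x with x ∈? B
  ... | yes x∈B = sym (mult-∈ B! x∈B)
  ... | no  x∉B = sym (mult-∉ x∉B)

  -- The multi-set of nonzero elements

  from-to : ∀ x → Inverse.from order (Inverse.to order x) ≈ x
  from-to x = Inverse.strictlyInverseʳ order x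

  G∖0-unique : Unique (G∖0 G order)
  G∖0-unique = Unique.filter⁺ setoid (λ x → ¬? (x ≟ 0#))
    (Unique.map⁺ (≡.setoid (Fin n)) setoid from-injective (Unique≡.allFin⁺ n))
    where
    from-injective : ∀ {i j} → Inverse.from order i ≈ Inverse.from order j → i ≡ j
    from-injective {i} {j} eq = trans (sym (Inverse.strictlyInverseˡ order i))
      (trans (Inverse.to-cong order eq) (Inverse.strictlyInverseˡ order j))

  ≉0-resp-≈ : ∀ {x y} → x ≈ y → x ≉ 0# → y ≉ 0#
  ≉0-resp-≈ x≈y x≉0 y≈0 = x≉0 (G.trans x≈y y≈0)

  ∈G∖0 : ∀ {x} → x ≉ 0# → x ∈ G∖0 G order
  ∈G∖0 {x} x≉0 = Membership.∈-filter⁺ setoid (λ y → ¬? (y ≟ 0#)) ≉0-resp-≈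
    (Membership.∈-resp-≈ setoid (from-to x)
      (Membership.∈-map⁺ (≡.setoid (Fin n)) setoid (Inverse.from-cong order)
        (∈-allFin (Inverse.to order x))))
    x≉0

  mult-G∖0 : ∀ {x} → x ≉ 0# → mult x (G∖0 G order) ≡ 1
  mult-G∖0 x≉0 = mult-∈ G∖0-unique (∈G∖0 x≉0)

  -- Weights k̃ / kᵢ of a family

  module _ {m : ℕ} (F : DisjointFamily G order (Fin m)) where

    size : Fin m → ℕ
    size = sizes G order F

    weight : Fin m → ℕ
    weight i = (lcms size ℕ./ size i) {{nonempty F i}}

    weight*size : ∀ i → weight i * size i ≡ lcms size
    weight*size i = m/n*n≡m {{nonempty F i}} (∣lcms size i)

    -- A divisor of the nonzero number k̃ is at most k̃, so the quotient is at least 1.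
    weight>0 : ∀ i → 0 < weight i
    weight>0 i = m≥n⇒m/n>0 {{nonempty F i}} (∣⇒≤ {{lcms≢0 size (nonempty F)}} (∣lcms size i))

    extMult : Carrier → ℕ
    extMult x = mult x (externalDifferences G order F)

  -- Wins of the adversary and external differences

  module _ {m : ℕ} {S : Set} (sources : Fin m ↔ S) (A : DisjointFamily G order S) where

    private
      src : Fin m → S
      src = source G order sources A

      src-injective : ∀ {i j} → src i ≡ src j → i ≡ j
      src-injective {i} {j} eq = trans (sym (Inverse.strictlyInverseʳ sources i))
        (trans (cong (Inverse.from sources) eq) (Inverse.strictlyInverseʳ sources j))

      elts : S → List Carrier
      elts s = elements (member A s)

      others : S → List Carrier
      others = otherEncodings G order sources A

      _≟ˢ_ = _≟ₛ_ G order sources A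

    -- The sources of a code form an arbitrary set `S`, while a BSWEDF is indexed by `Fin m`. Along
    -- the identity bijection the members unfold to those of the given family, so the same lemmas
    -- serve both directions of the theorem.
    reindex : DisjointFamily G order (Fin m)
    reindex = record
      { member   = member A ∘ src
      ; nonempty = nonempty A ∘ src
      ; disjoint = λ i≢j → disjoint A (i≢j ∘ src-injective)
      }

    -- Each set is listed without repetition, and sets of different sources are disjoint; as `src`
    -- is injective, no source is listed twice. Hence a shifted encoding lands in the union at most
    -- once.
    others-unique : ∀ s → Unique (others s)
    others-unique s = Unique.concat⁺ setoid
      (All.map⁺ (All.universal (λ s′ → unique (member A s′)) _))
      (AllPairs.map⁺ (AllPairs.map (disjoint A)
        (Unique.filter⁺ (≡.setoid S) (λ s′ → ¬? (s′ ≟ˢ s))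
          (Unique.map⁺ (≡.setoid (Fin m)) (≡.setoid S) src-injective (Unique≡.allFin⁺ m)))))

    ∈others : ∀ {x i j} → i ≢ j → x ∈ elts (src i) → x ∈ others (src j)
    ∈others {x} {i} {j} i≢j x∈Aᵢ = Any.concatMap⁺ elts
      (Any.map (λ { refl → x∈Aᵢ })
        (∈-filter⁺ (λ s → ¬? (s ≟ˢ src j))
          (Any.map⁺ (Any.map (cong src) (∈-allFin i))) (i≢j ∘ src-injective)))

    wins : Carrier → Fin m → ℕ
    wins d i = length (winning G order sources A d (src i))

    -- Since `others (src j)` is free of repetitions, the winning test equals a multiplicity, which
    -- splits into one summand for each source other than `src j`. Exchanging the sums leaves the
    -- counts N(i , j).
    wins-∑ : ∀ d j → wins d j ≡
      ∑ (λ i → 𝟙 (¬? (i Fin.≟ j)) * ∑ (λ y → mult (y ⊹ d) (elts (src i))) (elts (src j))) (allFin m)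
    wins-∑ d j = begin
      wins d j
        ≡⟨ length-filter-∑ (λ g → (g ⊹ d) ∈? others (src j)) (elts (src j)) ⟩
      ∑ (λ y → 𝟙 ((y ⊹ d) ∈? others (src j))) Aⱼ
        ≡⟨ ∑-cong (λ y → 𝟙-∈? (others-unique (src j)) (y ⊹ d)) Aⱼ ⟩
      ∑ (λ y → mult (y ⊹ d) (others (src j))) Aⱼ
        ≡⟨ ∑-cong (λ y → mult-concatMap (y ⊹ d) elts ≢j) Aⱼ ⟩
      ∑ (λ y → ∑ (λ s → mult (y ⊹ d) (elts s)) ≢j) Aⱼ
        ≡⟨ ∑-comm (λ y s → mult (y ⊹ d) (elts s)) Aⱼ ≢j ⟩
      ∑ N ≢j
        ≡⟨ ∑-filter (λ s → ¬? (s ≟ˢ src j)) N (map src (allFin m)) ⟩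
      ∑ (λ s → 𝟙 (¬? (s ≟ˢ src j)) * N s) (map src (allFin m))
        ≡⟨ ∑-map _ src (allFin m) ⟩
      ∑ (λ i → 𝟙 (¬? (src i ≟ˢ src j)) * N (src i)) (allFin m)
        ≡⟨ ∑-cong (λ i → cong (_* N (src i))
             (𝟙-cong (¬? (src i ≟ˢ src j)) (¬? (i Fin.≟ j))
               (_∘ cong src) (_∘ src-injective))) (allFin m) ⟩
      ∑ (λ i → 𝟙 (¬? (i Fin.≟ j)) * N (src i)) (allFin m)
        ∎
      where
      open ≡-Reasoning
      Aⱼ : List Carrier
      Aⱼ = elts (src j)
      ≢j : List S
      ≢j = filter (λ s → ¬? (s ≟ˢ src j)) (map src (allFin m))
      N : S → ℕ
      N s = ∑ (λ y → mult (y ⊹ d) (elts s)) Aⱼ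

    -- The weight k̃ / kⱼ depends only on the set that contains the subtrahend y, which is the
    -- encoding being shifted. With j outermost the weight factors out, and the rest is the number
    -- of wins at source j.
    extMult-wins : ∀ d → extMult reindex d ≡ ∑ℕ (λ j → weight reindex j * wins d j)
    extMult-wins d = begin
      extMult reindex d
        ≡⟨ mult-concatMap d _ (allFin m) ⟩
      ∑ (λ i → mult d (concatMap (λ j → D G order (Aᵢ i) (Ã j)) (filter (i≢? i) (allFin m)))) (allFin m)
        ≡⟨ ∑-cong (λ i → trans (mult-concatMap d _ (filter (i≢? i) (allFin m)))
                               (∑-filter (i≢? i) _ (allFin m))) (allFin m) ⟩
      ∑ (λ i → ∑ (λ j → 𝟙 (i≢? i j) * mult d (D G order (Aᵢ i) (Ã j))) (allFin m)) (allFin m)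
        -- The external differences are listed by i first, whereas wins are counted for each j.
        ≡⟨ ∑-comm _ (allFin m) (allFin m) ⟩
      ∑ (λ j → ∑ (λ i → 𝟙 (i≢? i j) * mult d (D G order (Aᵢ i) (Ã j))) (allFin m)) (allFin m)
        ≡⟨ ∑-cong (λ j → ∑-cong (λ i → factor i j) (allFin m)) (allFin m) ⟩
      ∑ (λ j → ∑ (λ i → weight reindex j * (𝟙 (i≢? i j) * N i j)) (allFin m)) (allFin m)
        ≡⟨ ∑-cong (λ j → trans (*-distribˡ-∑ (weight reindex j) _ (allFin m))
                               (cong (weight reindex j *_) (sym (wins-∑ d j)))) (allFin m) ⟩
      ∑ (λ j → weight reindex j * wins d j) (allFin m)
        ≡⟨ ∑-allFin (λ j → weight reindex j * wins d j) ⟩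
      ∑ℕ (λ j → weight reindex j * wins d j)
        ∎
      where
      open ≡-Reasoning
      i≢? : ∀ i j → Dec (i ≢ j)
      i≢? i j = ¬? (i Fin.≟ j)
      Aᵢ Ã : Fin m → List Carrier
      Aᵢ i = elts (src i)
      Ã = weighted G order reindex
      N : Fin m → Fin m → ℕ
      N i j = ∑ (λ y → mult (y ⊹ d) (Aᵢ i)) (Aᵢ j)
      factor : ∀ i j → 𝟙 (i≢? i j) * mult d (D G order (Aᵢ i) (Ã j)) ≡
                       weight reindex j * (𝟙 (i≢? i j) * N i j)
      factor i j = begin
        𝟙 (i≢? i j) * mult d (D G order (Aᵢ i) (Ã j))
          ≡⟨ cong (𝟙 (i≢? i j) *_) (trans (mult-D d (Aᵢ i) (Ã j)) (∑-⊠ _ (weight reindex j) (Aᵢ j))) ⟩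
        𝟙 (i≢? i j) * (weight reindex j * N i j)
          ≡⟨ solve 3 (λ x y z → x :* (y :* z) := y :* (x :* z)) refl (𝟙 (i≢? i j)) (weight reindex j) (N i j) ⟩
        weight reindex j * (𝟙 (i≢? i j) * N i j)
          ∎
        where open +-*-Solver

    -- Zero and nonzero differences, and bounds on multiplicities

    wins-0 : ∀ {d} → d ≈ 0# → ∀ j → wins d j ≡ 0
    wins-0 {d} d≈0 j = cong length (filter-none (λ g → (g ⊹ d) ∈? others (src j))
      (All.tabulateₛ setoid λ {g} g∈Aⱼ g+d∈ →
        let s≢j , g+d∈Aₛ = All.lookupAny
              (All.all-filter (λ s → ¬? (s ≟ˢ src j)) (map src (allFin m)))
              (Any.concatMap⁻ elts g+d∈)
            g+d≈g = G.trans (G.∙-congˡ d≈0) (G.identityʳ g)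
        -- The shift by zero leaves `g` in its own set, which is disjoint from that of every other
        -- source.
        in disjoint A s≢j (Membership.∈-resp-≈ setoid g+d≈g g+d∈Aₛ , g∈Aⱼ)))

    extMult-0 : ∀ {d} → d ≈ 0# → extMult reindex d ≡ 0
    extMult-0 {d} d≈0 = begin
      extMult reindex d                        ≡⟨ extMult-wins d ⟩
      ∑ℕ (λ j → weight reindex j * wins d j)   ≡⟨ ∑ℕ.cong (λ j → trans
                                                    (cong (weight reindex j *_) (wins-0 d≈0 j))
                                                    (ℕ.*-zeroʳ (weight reindex j))) ⟩
      ∑ℕ {m} (λ _ → 0)                         ≡⟨ ∑ℕ.replicate-zero m ⟩
      0                                        ∎
      where open ≡-Reasoning

    extMult>0⇒≉0 : ∀ {d} → 0 < extMult reindex d → d ≉ 0#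
    extMult>0⇒≉0 0<ext d≈0 = ℕ.<⇒≢ 0<ext (sym (extMult-0 d≈0))

    -- The shift by x - y carries the encoding y of source j to x, an encoding of another source. So
    -- source j has a win, and its weight is positive.
    extMult-difference : ∀ {i j x y} → i ≢ j → x ∈ elts (src i) → y ∈ elts (src j) →
                         0 < extMult reindex (x ⊖ y)
    extMult-difference {i} {j} {x} {y} i≢j x∈Aᵢ y∈Aⱼ = begin-strict
      0                                                <⟨ ℕ.*-mono-< (weight>0 reindex j) wins>0 ⟩
      weight reindex j * wins (x ⊖ y) j                ≤⟨ term≤∑ℕ (λ j → weight reindex j * wins (x ⊖ y) j) j ⟩
      ∑ℕ (λ j → weight reindex j * wins (x ⊖ y) j)     ≡⟨ extMult-wins (x ⊖ y) ⟨
      extMult reindex (x ⊖ y)                          ∎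
      where
      open ℕ.≤-Reasoning
      wins>0 : 0 < wins (x ⊖ y) j
      wins>0 = filter-some (λ g → (g ⊹ (x ⊖ y)) ∈? others (src j))
        (Any.map (λ y≈g → Membership.∈-resp-≈ setoid
          (G.sym (G.trans (G.∙-congʳ (G.sym y≈g)) (≈-⇒+≈ G.refl))) (∈others i≢j x∈Aᵢ)) y∈Aⱼ)

    -- Two distinct sources have nonempty sets, and any difference between these will do.
    ∃-extMult>0 : ∀ {i j : Fin m} → i ≢ j → ∃[ d ] 0 < extMult reindex d
    ∃-extMult>0 {i} {j} i≢j =
      let x , x∈Aᵢ = inhabited (elts (src i)) (nonempty A (src i))
          y , y∈Aⱼ = inhabited (elts (src j)) (nonempty A (src j))
      in x ⊖ y , extMult-difference i≢j x∈Aᵢ y∈Aⱼ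
      where
      inhabited : ∀ xs → NonZero (length xs) → ∃[ x ] x ∈ xs
      inhabited (x ∷ xs) _ = x , here G.refl

    -- A nonzero d has multiplicity exactly `lam` on the right of the inclusion, and zero is never
    -- an external difference. Inclusion of multi-sets thus amounts to an inequality at each nonzero
    -- d; `bounds⁻` is the converse.
    bounds⁺ : ∀ {lam} → 0 < lam → (∀ d → d ≉ 0# → extMult reindex d ≤ lam) →
              Bounds G order reindex lam
    bounds⁺ {lam} 0<lam ext≤lam = 0<lam , λ d → bound d (d ≟ 0#)
      where
      open ℕ.≤-Reasoning
      bound : ∀ d → Dec (d ≈ 0#) → extMult reindex d ≤ mult d (_⊠_ G order lam (G∖0 G order))
      bound d (yes d≈0) = ≤-trans (ℕ.≤-reflexive (extMult-0 d≈0)) z≤n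
      bound d (no  d≉0) = begin
        extMult reindex d                        ≤⟨ ext≤lam d d≉0 ⟩
        lam                                      ≡⟨ ℕ.*-identityʳ lam ⟨
        lam * 1                                  ≡⟨ cong (lam *_) (mult-G∖0 d≉0) ⟨
        lam * mult d (G∖0 G order)               ≡⟨ mult-⊠ d lam (G∖0 G order) ⟨
        mult d (_⊠_ G order lam (G∖0 G order))   ∎

    bounds⁻ : ∀ {lam} → Bounds G order reindex lam → ∀ d → d ≉ 0# → extMult reindex d ≤ lam
    bounds⁻ {lam} (_ , ext⊆) d d≉0 = begin
      extMult reindex d                        ≤⟨ ext⊆ d ⟩
      mult d (_⊠_ G order lam (G∖0 G order))   ≡⟨ mult-⊠ d lam (G∖0 G order) ⟩
      lam * mult d (G∖0 G order)               ≡⟨ cong (lam *_) (mult-G∖0 d≉0) ⟩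
      lam * 1                                  ≡⟨ ℕ.*-identityʳ lam ⟩
      lam                                      ∎
      where open ℕ.≤-Reasoning

    -- If no nonzero d reaches lam, then lam - 1 is a bound as well; it is positive
    -- because some external difference occurs.
    smallest⇒attained : ∀ {i j : Fin m} → i ≢ j → ∀ {lam} → Bounds G order reindex lam →
      (∀ lam′ → Bounds G order reindex lam′ → lam ≤ lam′) →
      ∃[ d ] (d ≉ 0#) × (extMult reindex d ≡ lam)
    smallest⇒attained i≢j {lam@(suc l)} bounds smallest
      with any? (λ k → lam ≤? extMult reindex (Inverse.from order k))
    ... | yes (k , lam≤ext) =
      -- The bound `lam` is a successor, so the multiplicity found is positive and excludes zero.
      let d≉0 = extMult>0⇒≉0 (≤-trans (s≤s z≤n) lam≤ext)
      in Inverse.from order k , d≉0 , ℕ.≤-antisym (bounds⁻ bounds _ d≉0) lam≤ext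
    ... | no  lam≰ext = contradiction (smallest l (bounds⁺ 0<l (λ d _ → ext≤l d))) ℕ.1+n≰n
      where
      ext≤l : ∀ d → extMult reindex d ≤ l
      ext≤l d = ℕ.≤-pred (ℕ.≰⇒> λ lam≤ext → lam≰ext (Inverse.to order d ,
        ≤-trans lam≤ext (ℕ.≤-reflexive (mult-cong (G.sym (from-to d)) (externalDifferences G order reindex)))))
      0<l : 0 < l
      0<l = let d , 0<ext = ∃-extMult>0 i≢j in ≤-trans 0<ext (ext≤l d)
    smallest⇒attained i≢j {zero} (() , _)

    -- The winning probability as a fraction with denominator k̃ m

    module _ .{{_ : NonZero m}} where

      -- Writing 1 / kᵢ as (k̃ / kᵢ) / k̃ gives all summands the denominator k̃, and the numerators
      -- add up to the multiplicity of d. The lcm is a variable `L` because the sizes of the family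
      -- agree with `K` only propositionally.
      winProbability-extMult : ∀ d {L} .{{_ : NonZero (L * m)}} → lcms (size reindex) ≡ L →
        winProbability G order sources A d ≡ + extMult reindex d / (L * m)
      winProbability-extMult d {L} refl = begin
        (+ 1 / m) ℚ.* ∑ℚ (λ i → (+ 1 / size reindex i) {{nonempty A (src i)}} ℚ.* (+ wins d i / 1))
          ≡⟨ cong ((+ 1 / m) ℚ.*_) (trans (∑ℚ.cong term) (∑ℚ-/ (λ i → weight reindex i * wins d i) L)) ⟩
        (+ 1 / m) ℚ.* (+ ∑ℕ (λ i → weight reindex i * wins d i) / L)
          ≡⟨ cong (λ x → (+ 1 / m) ℚ.* (+ x / L)) (extMult-wins d) ⟨
        (+ 1 / m) ℚ.* (+ extMult reindex d / L)
          ≡⟨ /-* 1 (extMult reindex d) m L ⟩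
        (+ (1 * extMult reindex d) / (m * L)) {{m*n≢0 m L}}
          ≡⟨ ℚ./-cong {{m*n≢0 m L}} (cong +_ (ℕ.*-identityˡ (extMult reindex d))) (ℕ.*-comm m L) ⟩
        + extMult reindex d / (L * m)
          ∎
        where
        open ≡-Reasoning
        instance
          L≢0 : NonZero L
          L≢0 = lcms≢0 (size reindex) (nonempty reindex)
        term : ∀ i → (+ 1 / size reindex i) {{nonempty A (src i)}} ℚ.* (+ wins d i / 1) ≡
                     + (weight reindex i * wins d i) / L
        term i = trans (/-* 1 (wins d i) (size reindex i) 1)
          (/-≡ (1 * wins d i) (weight reindex i * wins d i) (size reindex i * 1) L
            {{m*n≢0 (size reindex i) 1}} (begin
            1 * wins d i * L
              ≡⟨ cong (1 * wins d i *_) (weight*size reindex i) ⟨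
            1 * wins d i * (weight reindex i * size reindex i)
              ≡⟨ solve 3 (λ w c k → con 1 :* w :* (c :* k) := c :* w :* (k :* con 1)) refl
                   (wins d i) (weight reindex i) (size reindex i) ⟩
            weight reindex i * wins d i * (size reindex i * 1)
              ∎))
          where
          open +-*-Solver
          instance
            k≢0 : NonZero (size reindex i)
            k≢0 = nonempty A (src i)

-- Equivalence of weak AMD codes and BSWEDFs

theorem1 : ∀ {c ℓ} (G : AbelianGroup c ℓ) (n : ℕ) (order : HasOrder G n)
    (m : ℕ) (2≤m : 2 ≤ m)
    (K : Vector ℕ m) (K≢0 : ∀ i → NonZero (K i))
    (lam : ℕ) (lam≢0 : NonZero lam) →
    let instance
          m≢0 : NonZero m
          m≢0 = >-nonZero (≤-trans (s≤s z≤n) 2≤m)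
          k̃m≢0 : NonZero (lcms K * m)
          k̃m≢0 = m*n≢0 (lcms K) m {{lcms≢0 K K≢0}}
        a : ℕ
        a = ∑ℕ K
        ρ : ℚ
        ρ = + lam / (lcms K * m)
    in (Σ[ C ∈ WeakAMDCode G order m a ρ ] (∀ i → WeakAMDCode.encodingSize C i ≡ K i))
       ⇔ BSWEDF G order m K a lam
-- Matching shows `m` as a double successor, which makes the indices 0 and 1 available.
theorem1 G n order m@(suc (suc _)) 2≤m@(s≤s (s≤s _)) K K≢0 lam lam≢0 = mk⇔ code⇒family family⇒code
  where
  instance
    k̃m≢0 : NonZero (lcms K * m)
    k̃m≢0 = m*n≢0 (lcms K) m {{lcms≢0 K K≢0}}

  code⇒family : (Σ[ C ∈ WeakAMDCode G order m (∑ℕ K) (+ lam / (lcms K * m)) ]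
                  (∀ i → WeakAMDCode.encodingSize C i ≡ K i)) →
                BSWEDF G order m K (∑ℕ K) lam
  code⇒family (C , sizes≡K) = record
    { family   = reindex G order sources encodings
    ; sizes≡K  = sizes≡K
    ; total    = total
    ; bounds   = bounds⁺ G order sources encodings (>-nonZero⁻¹ lam {{lam≢0}}) λ d d≉0 →
        -- Both ρ_Δ and ρ have denominator k̃ m, so comparing them is comparing numerators.
        /-≤⁻ (ext d) lam (lcms K * m) (subst (ℚ._≤ _) (win≡ d) (maximal d d≉0))
    ; smallest = λ lam′ bounds′ →
        -- Where ρ is attained the multiplicity is exactly `lam`, and any other bound `lam′` has to
        -- dominate it.
        let d , d≉0 , win≡ρ = attained
        in subst (_≤ lam′)
             (/-injective (ext d) lam (lcms K * m) (trans (sym (win≡ d)) win≡ρ))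
             (bounds⁻ G order sources encodings bounds′ d d≉0)
    }
    where
    open WeakAMDCode C
    ext = extMult G order (reindex G order sources encodings)
    win≡ = λ d → winProbability-extMult G order sources encodings d (lcms-cong sizes≡K)

  family⇒code : BSWEDF G order m K (∑ℕ K) lam →
                Σ[ C ∈ WeakAMDCode G order m (∑ℕ K) (+ lam / (lcms K * m)) ]
                  (∀ i → WeakAMDCode.encodingSize C i ≡ K i)
  family⇒code F = record
    { S         = Fin m
    ; sources   = ↔-id (Fin m)
    ; encodings = family
    ; total     = total
    ; attained  =
        -- The sources 0 and 1 are the two distinct indices that guarantee an external difference.
        let d , d≉0 , ext≡lam = smallest⇒attained G order (↔-id (Fin m)) family
              {Fin.zero} {Fin.suc Fin.zero} (λ ()) bounds smallest
        in d , d≉0 , trans (win≡ d) (cong (λ x → + x / (lcms K * m)) ext≡lam)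
    ; maximal   = λ d d≉0 → subst (ℚ._≤ _) (sym (win≡ d))
        (/-≤⁺ (ext d) lam (lcms K * m) (bounds⁻ G order (↔-id (Fin m)) family bounds d d≉0))
    } , sizes≡K
    where
    open BSWEDF F
    ext = extMult G order (reindex G order (↔-id (Fin m)) family)
    win≡ = λ d → winProbability-extMult G order (↔-id (Fin m)) family d (lcms-cong sizes≡K)
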